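{- Let $A\subseteq\omega$ be an infinite c.e. set, $n\ge1$, and let $\theta^{(n)}$ be a quasi-Gödel numbering of $\mathcal S^{(n)}_A$. Then there is no function $q\in\mathcal R^{(1)}$ such that for all $i\in\omega$: if $\theta^{(n)}_i\in\mathrm{Anf}^{(n)}_A$, then $\theta^{(n)}_{q(i)}\in\mathcal R^{(n)}$ and $\mathrm{graph}(\theta^{(n)}_i)\subset\mathrm{graph}(\theta^{(n)}_{q(i)})$.
   Context: $\omega$ is the set of natural numbers; $\mathcal R^{(n)}$ is the set of total computable functions $\omega^n\to\omega$. $\langle\cdot,\cdot\rangle:\omega^2\to\omega$ is a computable bijection with $\langle x,y\rangle\ge x,y$, extended by $\langle x\rangle=x$, $\langle x_1,\dots,x_{n+1}\rangle=\langle x_1,\langle x_2,\dots,x_{n+1}\rangle\rangle$. $\mathrm{Anf}^{(n)}_A$ is the set of partial functions from $\omega^n$ to $\omega$ whose domain is either empty or equal to $\{0,\dots,a-1\}^n$ for some $a\in A$, and $\mathcal S^{(n)}_A=\mathcal R^{(n)}\cup\mathrm{Anf}^{(n)}_A$. For an $n$-ary partial function $q$, $\mathrm{graph}(q)=\{\langle\langle\vec x\rangle,q(\vec x)\rangle:\vec x\in\mathrm{dom}(q)\}$, and the extended graph of $q$ is $\{\langle\langle\vec y\rangle,0\rangle:\vec y\in\omega^n\}\cup\{\langle\langle\vec x\rangle,q(\vec x)+1\rangle:\vec x\in\mathrm{dom}(q)\}$. A numbering of a set $X$ is a surjection $\omega\to X$. A numbering $\theta$ of $\mathcal S^{(n)}_A$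 is a quasi-Gödel numbering if: (QGN I) the extended graph of $(i,\vec x)\mapsto\theta_i(\vec x)$ is the range of a function in $\mathcal R^{(1)}$; and (QGN II) for every $k\in\mathcal R^{(2)}$ there is $v\in\mathcal R^{(1)}$ such that for all $i\in\omega$, $r\in\mathcal S^{(n)}_A$: if $\{k(i,t):t\in\omega\}$ is the extended graph of $r$, then $r=\theta_{v(i)}$. -}

module Defs where

open import Level using (0ℓ)
open import Data.Nat using (ℕ; zero; suc; _≤_; _<_; NonZero)
open import Data.Fin using (Fin)
open import Data.List using (List)
open import Data.List.Membership.Propositional renaming (_∈_ to _∈ₗ_)
open import Data.Product using (_×_; _,_; Σ-syntax; ∃-syntax; uncurry)
open import Data.Sum using (_⊎_)
open import Data.Vec using (Vec; []; _∷_; [_]; lookup; head; tail)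
open import Data.Vec.Relation.Unary.All using (All)
open import Data.Vec.Relation.Binary.Pointwise.Inductive using (Pointwise)
open import Function.Bundles using (_⇔_)
open import Function.Definitions using (Bijective)
open import Relation.Binary.PropositionalEquality using (_≡_)
open import Relation.Nullary using (¬_)
open import Relation.Unary using (Pred; _∈_; _≐_; _∪_; Empty)

-- Computability is given by the μ-recursive functions: codes `Rec n` for
-- n-ary partial recursive functions, and a big-step semantics.

data Rec : ℕ → Set where
  zer  : Rec 0
  succ : Rec 1
  proj : ∀ {n} → Fin n → Rec n
  comp : ∀ {m n} → Rec m → Vec (Rec n) m → Rec n
  prec : ∀ {n} → Rec n → Rec (suc (suc n)) → Rec (suc n)
  mini : ∀ {n} → Rec (suc n) → Rec n

infix 4 _⟦_⟧↓_

data _⟦_⟧↓_ : ∀ {n} → Rec n → Vec ℕ n → ℕ → Set where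
  ↓zer   : zer ⟦ [] ⟧↓ 0
  ↓succ  : ∀ {x} → succ ⟦ [ x ] ⟧↓ suc x
  ↓proj  : ∀ {n} {xs : Vec ℕ n} (i : Fin n) → proj i ⟦ xs ⟧↓ lookup xs i
  ↓comp  : ∀ {m n} {f : Rec m} {gs : Vec (Rec n) m} {xs ys z} →
           Pointwise (λ g y → g ⟦ xs ⟧↓ y) gs ys →
           f ⟦ ys ⟧↓ z →
           comp f gs ⟦ xs ⟧↓ z
  ↓prec0 : ∀ {n} {f : Rec n} {g : Rec (suc (suc n))} {xs z} →
           f ⟦ xs ⟧↓ z →
           prec f g ⟦ 0 ∷ xs ⟧↓ z
  ↓precS : ∀ {n} {f : Rec n} {g : Rec (suc (suc n))} {k xs y z} →
           prec f g ⟦ k ∷ xs ⟧↓ y →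
           g ⟦ k ∷ y ∷ xs ⟧↓ z →
           prec f g ⟦ suc k ∷ xs ⟧↓ z
  ↓mini  : ∀ {n} {f : Rec (suc n)} {xs y} →
           f ⟦ y ∷ xs ⟧↓ 0 →
           (∀ z → z < y → ∃[ w ] f ⟦ z ∷ xs ⟧↓ suc w) →
           mini f ⟦ xs ⟧↓ y

Computable : ∀ {n} → (Vec ℕ n → ℕ) → Set
Computable {n} f = Σ[ e ∈ Rec n ] (∀ xs → e ⟦ xs ⟧↓ f xs)

-- Computably enumerable: the domain of a partial recursive function.
CE : Pred ℕ 0ℓ → Set
CE A = Σ[ e ∈ Rec 1 ] A ≐ (λ x → ∃[ y ] e ⟦ [ x ] ⟧↓ y)

Finite : Pred ℕ 0ℓ → Set
Finite A = Σ[ l ∈ List ℕ ] (∀ x → x ∈ A → x ∈ₗ l)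

Infinite : Pred ℕ 0ℓ → Set
Infinite A = ¬ Finite A

-- A partial function is a single-valued relation, so that its domain need
-- not be decidable; `r at xs ↦ y` says that r is defined at xs with value y.
record PartialFun (n : ℕ) : Set₁ where
  field
    _at_↦_       : Vec ℕ n → ℕ → Set
    singleValued : ∀ {xs y z} → _at_↦_ xs y → _at_↦_ xs z → y ≡ z

open PartialFun public using (_at_↦_; singleValued)

dom : ∀ {n} → PartialFun n → Pred (Vec ℕ n) 0ℓ
dom r xs = ∃[ y ] r at xs ↦ y

-- Equality of partial functions.
infix 4 _≈_

_≈_ : ∀ {n} → PartialFun n → PartialFun n → Set
r ≈ s = ∀ xs y → r at xs ↦ y ⇔ s at xs ↦ y

𝓡 : ∀ {n} → Pred (PartialFun n) 0ℓ
𝓡 {n} r = Σ[ f ∈ (Vec ℕ n → ℕ) ] Computable f × (∀ xs y → r at xs ↦ y ⇔ f xs ≡ y)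

-- For n ≥ 1 the domain of a member may be empty for two reasons (the left
-- summand, or a = 0 on the right); `All (_< a)` is the cube {0, …, a-1}ⁿ.
Anf : ∀ {n} → Pred ℕ 0ℓ → Pred (PartialFun n) 0ℓ
Anf A r = Empty (dom r) ⊎ (∃[ a ] a ∈ A × dom r ≐ All (_< a))

𝓢 : ∀ {n} → Pred ℕ 0ℓ → Pred (PartialFun n) 0ℓ
𝓢 A = 𝓡 ∪ Anf A

record Pairing : Set where
  field
    ⟨_,_⟩      : ℕ → ℕ → ℕ
    computable : Computable (λ (xs : Vec ℕ 2) → ⟨ head xs , head (tail xs) ⟩)
    bijective  : Bijective _≡_ _≡_ (uncurry ⟨_,_⟩)
    boundˡ     : ∀ x y → x ≤ ⟨ x , y ⟩
    boundʳ     : ∀ x y → y ≤ ⟨ x , y ⟩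

range : (Vec ℕ 1 → ℕ) → Pred ℕ 0ℓ
range f z = ∃[ t ] f [ t ] ≡ z

Family : ℕ → Set₁
Family n = ℕ → PartialFun n

-- The (n+1)-ary partial function (i , x⃗) ↦ θᵢ(x⃗).
uncurried : ∀ {n} → Family n → PartialFun (suc n)
uncurried θ ._at_↦_ (i ∷ xs) y = θ i at xs ↦ y
uncurried θ .singleValued {i ∷ xs} = θ i .singleValued

IsNumberingOf : ∀ {n} → Family n → Pred (PartialFun n) 0ℓ → Set₁
IsNumberingOf θ X = (∀ i → θ i ∈ X) × (∀ r → r ∈ X → ∃[ i ] θ i ≈ r)

module _ (P : Pairing) where
  open Pairing P

  tuple : ∀ {n} .{{_ : NonZero n}} → Vec ℕ n → ℕ
  tuple (x ∷ [])         = x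
  tuple (x ∷ xs@(_ ∷ _)) = ⟨ x , tuple xs ⟩

  graph : ∀ {n} .{{_ : NonZero n}} → PartialFun n → Pred ℕ 0ℓ
  graph r z = ∃[ xs ] ∃[ y ] r at xs ↦ y × z ≡ ⟨ tuple xs , y ⟩

  extGraph : ∀ {n} .{{_ : NonZero n}} → PartialFun n → Pred ℕ 0ℓ
  extGraph r = (λ z → ∃[ ys ] z ≡ ⟨ tuple ys , 0 ⟩)
             ∪ (λ z → ∃[ xs ] ∃[ y ] r at xs ↦ y × z ≡ ⟨ tuple xs , suc y ⟩)

  record IsQuasiGödelNumbering {n} .{{_ : NonZero n}}
                               (A : Pred ℕ 0ℓ) (θ : Family n) : Set₁ where
    field
      numbering : IsNumberingOf θ (𝓢 A)
      qgnI      : Σ[ f ∈ (Vec ℕ 1 → ℕ) ]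
                  Computable f × range f ≐ extGraph (uncurried θ)
      qgnII     : (k : Vec ℕ 2 → ℕ) → Computable k →
                  Σ[ v ∈ (Vec ℕ 1 → ℕ) ] Computable v ×
                  (∀ i r → r ∈ 𝓢 A →
                   (λ z → ∃[ t ] k (i ∷ t ∷ []) ≡ z) ≐ extGraph r →
                   r ≈ θ (v [ i ]))

{-# OPTIONS --safe #-}

-- Diagonalisation.  Fix a ≥ 1 in A, and let rᵢ be the constant c + 1 on the cube
-- {0, …, a-1}ⁿ if j = θᵢ(i, …, i) and c = θ_{q(j)}(0, …, 0) are both defined, and
-- the empty function otherwise.  The extended graphs of the rᵢ are uniformly
-- enumerable, so rᵢ = θ_{v(i)} for a computable v.  Choose m such that θₘ is the
-- total function x⃗ ↦ v(x₁).  For i = m we get j = v(m), hence θⱼ = rₘ ∈ Anf.  The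
-- total function θ_{q(j)} extends rₘ, so c is defined and c = rₘ(0, …, 0) = c + 1.
module Submission where

open import Defs
open import Level using (0ℓ)
open import Data.Nat using (ℕ; NonZero)
open import Data.Product using (_×_; Σ-syntax)
open import Data.Vec using (Vec; [_])
open import Relation.Nullary using (¬_)
open import Relation.Unary using (Pred; _∈_; _⊆_)

open import Data.Empty using (⊥-elim)
open import Data.Fin using (Fin; zero; suc)
open import Data.List using ([]; _∷_)
open import Data.List.Membership.Propositional renaming (_∈_ to _∈ₗ_)
open import Data.List.Relation.Unary.Any using (here)
open import Data.Nat using (zero; suc; _+_; _*_; _∸_; _≤_; _<_; z≤n; s≤s)
open import Data.Nat.Properties
open import Data.Nat.Tactic.RingSolver using (solve-∀)
open import Data.Product using (_,_; ∃-syntax; proj₁; proj₂)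
open import Data.Sum using (inj₁; inj₂)
open import Data.Vec using ([]; _∷_; head; tail; lookup; replicate)
open import Data.Vec.Relation.Binary.Pointwise.Inductive using ([]; _∷_)
open import Data.Vec.Relation.Unary.All using (All; []; _∷_)
open import Function using (_∘_)
open import Function.Bundles using (mk⇔; Equivalence)
open import Relation.Binary.PropositionalEquality
  using (_≡_; refl; sym; trans; cong; cong₂; subst; module ≡-Reasoning)
open import Relation.Unary using (_≐_)

-- Closure properties of the computable functions

computable-cong : ∀ {n} {f g : Vec ℕ n → ℕ} →
                  (∀ xs → f xs ≡ g xs) → Computable f → Computable g
computable-cong f≗g (e , e↓) = e , λ xs → subst (e ⟦ xs ⟧↓_) (f≗g xs) (e↓ xs)

lookup-computable : ∀ {n} (i : Fin n) → Computable (λ xs → lookup xs i)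
lookup-computable i = proj i , λ _ → ↓proj i

head-computable : ∀ {n} → Computable (head {n = n})
head-computable = computable-cong (λ { (_ ∷ _) → refl }) (lookup-computable zero)

second-computable : ∀ {n} → Computable (λ (xs : Vec ℕ (2 + n)) → head (tail xs))
second-computable =
  computable-cong (λ { (_ ∷ _ ∷ _) → refl }) (lookup-computable (suc zero))

third-computable : ∀ {n} → Computable (λ (xs : Vec ℕ (3 + n)) → head (tail (tail xs)))
third-computable =
  computable-cong (λ { (_ ∷ _ ∷ _ ∷ _) → refl }) (lookup-computable (suc (suc zero)))

module _ {n} {g : Vec ℕ n → ℕ} where

  comp₁-computable : ∀ {f : Vec ℕ 1 → ℕ} → Computable f → Computable g →
                     Computable (λ xs → f [ g xs ])
  comp₁-computable (e , e↓) (d , d↓) =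
    comp e [ d ] , λ xs → ↓comp (d↓ xs ∷ []) (e↓ _)

  comp₂-computable : ∀ {f : Vec ℕ 2 → ℕ} {h : Vec ℕ n → ℕ} →
                     Computable f → Computable g → Computable h →
                     Computable (λ xs → f (g xs ∷ h xs ∷ []))
  comp₂-computable (e , e↓) (d , d↓) (d′ , d′↓) =
    comp e (d ∷ d′ ∷ []) , λ xs → ↓comp (d↓ xs ∷ d′↓ xs ∷ []) (e↓ _)

-- The recursion equations are hypotheses on an arbitrary `f`, so a function defined in any other
-- way qualifies once it satisfies them, mostly by `refl`.
primRec-computable : ∀ {n} {f : Vec ℕ (suc n) → ℕ} {g : Vec ℕ n → ℕ}
                     {h : Vec ℕ (2 + n) → ℕ} → Computable g → Computable h →
                     (∀ xs → g xs ≡ f (0 ∷ xs)) →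
                     (∀ k xs → h (k ∷ f (k ∷ xs) ∷ xs) ≡ f (suc k ∷ xs)) →
                     Computable f
primRec-computable {f = f} (d , d↓) (e , e↓) f0 fsuc = prec d e , run
  where
  run : ∀ xs → prec d e ⟦ xs ⟧↓ f xs
  run (zero ∷ xs)  = ↓prec0 (subst (d ⟦ xs ⟧↓_) (f0 xs) (d↓ xs))
  run (suc k ∷ xs) =
    ↓precS (run (k ∷ xs)) (subst (e ⟦ _ ⟧↓_) (fsuc k xs) (e↓ _))

suc-computable : ∀ {n} {f : Vec ℕ n → ℕ} → Computable f → Computable (suc ∘ f)
suc-computable (e , e↓) = comp succ [ e ] , λ xs → ↓comp (e↓ xs ∷ []) ↓succ

const-computable : ∀ {n} c → Computable (λ (_ : Vec ℕ n) → c)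
const-computable zero    = comp zer [] , λ _ → ↓comp [] ↓zer
const-computable (suc c) = suc-computable (const-computable c)

module _ {n} {f g : Vec ℕ n → ℕ} (F : Computable f) (G : Computable g) where

  +-computable : Computable (λ xs → f xs + g xs)
  +-computable = comp₂-computable {f = λ xs → head xs + head (tail xs)}
    (primRec-computable head-computable (suc-computable second-computable)
      (λ _ → refl) (λ _ _ → refl))
    F G

  ∸-computable : Computable (λ xs → f xs ∸ g xs)
  -- Recursion runs on the first argument, so the subtrahend comes first: x ∸ suc k is the
  -- predecessor of x ∸ k.
  ∸-computable = comp₂-computable {f = λ xs → head (tail xs) ∸ head xs}
    (primRec-computable head-computable
      (comp₁-computable {f = λ xs → head xs ∸ 1}
        (primRec-computable (const-computable 0) head-computable
          (λ _ → refl) (λ _ _ → refl))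
        second-computable)
      (λ _ → refl)
      (λ k xs → trans (∸-+-assoc (head xs) k 1) (cong (head xs ∸_) (+-comm k 1))))
    G F

*-computable : ∀ {n} {f g : Vec ℕ n → ℕ} → Computable f → Computable g →
               Computable (λ xs → f xs * g xs)
*-computable = comp₂-computable {f = λ xs → head xs * head (tail xs)}
  (primRec-computable (const-computable 0)
    (+-computable third-computable second-computable)
    (λ _ → refl) (λ _ _ → refl))

-- Equality as the vanishing of a computable number

opaque
  -- This is |x - y|, since at least one of the two truncated differences is 0.
  gap : ℕ → ℕ → ℕ
  gap x y = (x ∸ y) + (y ∸ x)

  ≡⇒gap≡0 : ∀ {x y} → x ≡ y → gap x y ≡ 0
  ≡⇒gap≡0 {x} refl = cong₂ _+_ (n∸n≡0 x) (n∸n≡0 x)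

  gap≡0⇒≡ : ∀ {x y} → gap x y ≡ 0 → x ≡ y
  gap≡0⇒≡ {x} {y} eq = ≤-antisym (m∸n≡0⇒m≤n (m+n≡0⇒m≡0 (x ∸ y) eq))
                                 (m∸n≡0⇒m≤n (m+n≡0⇒n≡0 (x ∸ y) eq))

  gap-computable : ∀ {n} {f g : Vec ℕ n → ℕ} → Computable f → Computable g →
                   Computable (λ xs → gap (f xs) (g xs))
  gap-computable F G = +-computable (∸-computable F G) (∸-computable G F)

-- Decoding numbers into vectors

-- The integer square root: it increases at suc t exactly when suc t is a square.
root : ℕ → ℕ
root zero    = 0
root (suc t) = root t + (1 ∸ (suc (root t) * suc (root t) ∸ suc t))

square-suc : ∀ r → suc r * suc r ≡ suc (r * r + (r + r))
square-suc = solve-∀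

-- The numbers r² + x with x ≤ 2r fill the interval from r² up to (r + 1)² - 1, on which the root
-- stays constant. It rises only on entering the next interval, so the case x = 0 falls back on the
-- last number of the previous one.
root-square+ : ∀ r x → x ≤ r + r → root (r * r + x) ≡ r
root-square+ zero    zero    _ = refl
root-square+ (suc r) zero    _ = begin
  root (suc r * suc r + 0)          ≡⟨ cong root (+-identityʳ (suc r * suc r)) ⟩
  root (suc r * suc r)              ≡⟨ cong root (square-suc r) ⟩
  root (suc t)                      ≡⟨ cong (λ ρ → ρ + (1 ∸ (suc ρ * suc ρ ∸ suc t)))
                                         (root-square+ r (r + r) ≤-refl) ⟩
  r + (1 ∸ (suc r * suc r ∸ suc t)) ≡⟨ cong (λ d → r + (1 ∸ d))
                                         (m≤n⇒m∸n≡0 (≤-reflexive (square-suc r))) ⟩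
  r + 1                             ≡⟨ +-comm r 1 ⟩
  suc r                             ∎
  where
  open ≡-Reasoning
  t = r * r + (r + r)
root-square+ r (suc x) x<r+r = begin
  root (r * r + suc x)              ≡⟨ cong root (+-suc (r * r) x) ⟩
  root (suc t)                      ≡⟨ cong (λ ρ → ρ + (1 ∸ (suc ρ * suc ρ ∸ suc t)))
                                         (root-square+ r x (<⇒≤ x<r+r)) ⟩
  -- Here suc t is still below (r + 1)², so the inner difference is positive and the increment is 0.
  r + (1 ∸ (suc r * suc r ∸ suc t)) ≡⟨ cong (r +_) (m≤n⇒m∸n≡0 (m<n⇒0<n∸m t+1<[r+1]²)) ⟩
  r + 0                             ≡⟨ +-identityʳ r ⟩
  r                                 ∎
  where
  open ≡-Reasoning
  t = r * r + x
  t+1<[r+1]² : suc t < suc r * suc r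
  t+1<[r+1]² = subst (suc t <_) (sym (square-suc r)) (s≤s (+-monoʳ-< (r * r) x<r+r))

-- The decoding of t = r² + x with x ≤ r is (x , r - x).
opaque
  left right : ℕ → ℕ
  left  t = t ∸ root t * root t
  right t = root t ∸ left t

  left-right-surjective : ∀ x y → ∃[ t ] left t ≡ x × right t ≡ y
  left-right-surjective x y = t , left-t , right-t
    where
    r t : ℕ
    r = x + y
    t = r * r + x
    root-t : root t ≡ r
    root-t = root-square+ r x (≤-trans (m≤m+n x y) (m≤m+n r r))
    left-t : left t ≡ x
    left-t = trans (cong (λ ρ → t ∸ ρ * ρ) root-t) (m+n∸m≡n (r * r) x)
    right-t : right t ≡ y
    right-t = trans (cong₂ _∸_ root-t left-t) (m+n∸m≡n x y)

-- `left` and `right` are primitive recursive, whereas inverting the given pairing would call for a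
-- search. An enumeration may repeat elements, so surjectivity is all that is asked of the decoding.
decode : ∀ n → ℕ → Vec ℕ n
decode zero    t = []
decode (suc n) t = left t ∷ decode n (right t)

decode-surjective : ∀ {n} (xs : Vec ℕ n) → ∃[ t ] decode n t ≡ xs
decode-surjective []       = 0 , refl
decode-surjective (x ∷ xs) =
  let u , decode-u = decode-surjective xs
      t , left-t , right-t = left-right-surjective x u
  in t , cong₂ _∷_ left-t (trans (cong (decode _) right-t) decode-u)

module _ {n} {f : Vec ℕ n → ℕ} (F : Computable f) where

  root-computable : Computable (root ∘ f)
  root-computable = comp₁-computable {f = root ∘ head}
    (primRec-computable (const-computable 0)
      (+-computable second-computable
        (∸-computable (const-computable 1)
          (∸-computable
            (*-computable (suc-computable second-computable)
                          (suc-computable second-computable))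
            (suc-computable head-computable))))
      (λ _ → refl) (λ _ _ → refl))
    F

  opaque
    unfolding left right

    left-computable : Computable (left ∘ f)
    left-computable = ∸-computable F (*-computable root-computable root-computable)

    right-computable : Computable (right ∘ f)
    right-computable = ∸-computable root-computable left-computable

-- Cubes: a numerical membership test and the choice of a side length

excess : ∀ {n} → ℕ → Vec ℕ n → ℕ
excess a []       = 0
excess a (x ∷ xs) = (suc x ∸ a) + excess a xs

excess≡0⇒All< : ∀ {n} a (xs : Vec ℕ n) → excess a xs ≡ 0 → All (_< a) xs
excess≡0⇒All< a []       _  = []
excess≡0⇒All< a (x ∷ xs) eq =
  m∸n≡0⇒m≤n (m+n≡0⇒m≡0 (suc x ∸ a) eq) ∷
  excess≡0⇒All< a xs (m+n≡0⇒n≡0 (suc x ∸ a) eq)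

All<⇒excess≡0 : ∀ {n} a {xs : Vec ℕ n} → All (_< a) xs → excess a xs ≡ 0
All<⇒excess≡0 a []           = refl
All<⇒excess≡0 a (x<a ∷ xs<a) = cong₂ _+_ (m≤n⇒m∸n≡0 x<a) (All<⇒excess≡0 a xs<a)

All<-replicate0 : ∀ {a} n → 0 < a → All (_< a) (replicate n 0)
All<-replicate0 zero    _   = []
All<-replicate0 (suc n) 0<a = 0<a ∷ All<-replicate0 n 0<a

-- The length is fixed outside the computation, so each coordinate contributes its own composition
-- of `left` with iterated `right`.
excess-decode-computable : ∀ {m} a n {t : Vec ℕ m → ℕ} → Computable t →
                           Computable (λ xs → excess a (decode n (t xs)))
excess-decode-computable a zero    T = const-computable 0
excess-decode-computable a (suc n) T =
  +-computable
    (∸-computable (suc-computable (left-computable T)) (const-computable a))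
    (excess-decode-computable a n (right-computable T))

-- Otherwise A would be contained in {0}. Infinity, as a negation, yields no witness; the double
-- negation is enough for refuting an extension function.
infinite⇒¬¬positive : ∀ {A : Pred ℕ 0ℓ} → Infinite A → ¬ ¬ (∃[ a ] a ∈ A × 0 < a)
infinite⇒¬¬positive {A} inf none = inf (0 ∷ [] , only-0)
  where
  only-0 : ∀ x → x ∈ A → x ∈ₗ 0 ∷ []
  only-0 zero    _   = here refl
  only-0 (suc x) x∈A = ⊥-elim (none (suc x , x∈A , s≤s z≤n))

-- Tuples and extended graphs

module _ (P : Pairing) where
  open Pairing P

  pair-injective : ∀ {x y x′ y′} → ⟨ x , y ⟩ ≡ ⟨ x′ , y′ ⟩ → x ≡ x′ × y ≡ y′
  pair-injective eq with refl ← proj₁ bijective eq = refl , refl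

  tuple-injective : ∀ {n} .{{_ : NonZero n}} {xs ys : Vec ℕ n} →
                    tuple P xs ≡ tuple P ys → xs ≡ ys
  tuple-injective {xs = x ∷ []}    {y ∷ []}    refl = refl
  tuple-injective {xs = x ∷ _ ∷ _} {y ∷ _ ∷ _} eq   =
    let x≡y , eq′ = pair-injective eq in cong₂ _∷_ x≡y (tuple-injective eq′)

  pair-computable : ∀ {n} {f g : Vec ℕ n → ℕ} → Computable f → Computable g →
                    Computable (λ xs → ⟨ f xs , g xs ⟩)
  pair-computable = comp₂-computable computable

  tuple-replicate-computable : ∀ {m} n {f : Vec ℕ m → ℕ} → Computable f →
    Computable (λ xs → tuple P (replicate (suc n) (f xs)))
  tuple-replicate-computable zero    F = F
  tuple-replicate-computable (suc n) F =
    pair-computable F (tuple-replicate-computable n F)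

  tuple-decode-computable : ∀ {m} n {t : Vec ℕ m → ℕ} → Computable t →
    Computable (λ xs → tuple P (decode (suc n) (t xs)))
  tuple-decode-computable zero    T = left-computable T
  tuple-decode-computable (suc n) T =
    pair-computable (left-computable T)
                    (tuple-decode-computable n (right-computable T))

  graph-at : ∀ {n} .{{_ : NonZero n}} (r : PartialFun n) {xs y} →
             ⟨ tuple P xs , y ⟩ ∈ graph P r → r at xs ↦ y
  graph-at r {xs} (xs′ , y′ , r↦ , eq)
    with eq₁ , refl ← pair-injective eq
    with refl ← tuple-injective {xs = xs} {xs′} eq₁ = r↦

  -- The shift of values by one separates the genuine entries of the graph from the padding with 0,
  -- and injectivity of the coding does the rest.
  extGraph-suc : ∀ {n} .{{_ : NonZero n}} (r : PartialFun n) {xs y} →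
                 ⟨ tuple P xs , suc y ⟩ ∈ extGraph P r → r at xs ↦ y
  extGraph-suc r (inj₁ (_ , eq)) with () ← proj₂ (pair-injective eq)
  extGraph-suc r (inj₂ (xs′ , y′ , r↦ , eq))
    with eq₁ , refl ← pair-injective eq = graph-at r (xs′ , y′ , r↦ , cong ⟨_, y′ ⟩ eq₁)

  -- `tests` and `value` are the enumeration of the extended graphs of the
  -- functions rᵢ: (s , j) and (s′ , c) guess stages s, s′ at which f shows that
  -- θᵢ(i, …, i) = j and θ_{q(j)}(0, …, 0) = c, and b ≠ 0 makes `tests` fail,
  -- so that ⟨ x⃗ , 0 ⟩ is produced.
  module Diagonal (n : ℕ) (θ : Family (suc n)) (f q : Vec ℕ 1 → ℕ)
                  (f≐θ : range f ≐ extGraph P (uncurried θ)) (a : ℕ) where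

    N : ℕ
    N = suc n

    𝟎 : Vec ℕ N
    𝟎 = replicate N 0

    θ↦⇒stage : ∀ {i} xs {y} → θ i at xs ↦ y →
               ∃[ s ] f [ s ] ≡ ⟨ ⟨ i , tuple P xs ⟩ , suc y ⟩
    θ↦⇒stage (x ∷ xs) θ↦ = proj₂ f≐θ (inj₂ (_ ∷ x ∷ xs , _ , θ↦ , refl))

    stage⇒θ↦ : ∀ {i} xs {y} s → f [ s ] ≡ ⟨ ⟨ i , tuple P xs ⟩ , suc y ⟩ →
               θ i at xs ↦ y
    stage⇒θ↦ (x ∷ xs) s eq = extGraph-suc (uncurried θ) {_ ∷ x ∷ xs} (proj₁ f≐θ (s , eq))

    -- The condition on j and c does not mention the argument, so the domain is the whole cube or
    -- empty, and the condition itself can be enumerated.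
    r : Family N
    r i ._at_↦_ xs y = All (_< a) xs × (∃[ j ] ∃[ c ]
      θ i at replicate N i ↦ j × θ (q [ j ]) at 𝟎 ↦ c × y ≡ suc c)
    r i .singleValued (_ , j , c , θᵢ↦j , θ↦c , refl) (_ , j′ , c′ , θᵢ↦j′ , θ↦c′ , refl)
      with refl ← θ i .singleValued θᵢ↦j θᵢ↦j′ =
      cong suc (θ (q [ j ]) .singleValued θ↦c θ↦c′)

    tests : ℕ → Vec ℕ (5 + N) → ℕ
    tests i (b ∷ s ∷ j ∷ s′ ∷ c ∷ xs) =
      b + (gap (f [ s ]) ⟨ ⟨ i , tuple P (replicate N i) ⟩ , suc j ⟩ +
          (gap (f [ s′ ]) ⟨ ⟨ q [ j ] , tuple P 𝟎 ⟩ , suc c ⟩ +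
           excess a xs))

    value : ℕ → Vec ℕ (5 + N) → ℕ
    value i w@(_ ∷ _ ∷ _ ∷ _ ∷ c ∷ xs) =
      -- The factor `1 ∸ tests i w` is 1 if all tests pass and 0 otherwise. One successor belongs to
      -- the diagonal value c + 1, the other to the shift in the extended graph.
      ⟨ tuple P xs , (1 ∸ tests i w) * suc (suc c) ⟩

    tests≡0⇒r↦ : ∀ {i} b s j s′ {c xs} → tests i (b ∷ s ∷ j ∷ s′ ∷ c ∷ xs) ≡ 0 →
                 r i at xs ↦ suc c
    tests≡0⇒r↦ {i} b s j s′ {c} {xs} eq =
      excess≡0⇒All< a xs (m+n≡0⇒n≡0 (gap (f [ s′ ]) _) eq₂) , j , c ,
      stage⇒θ↦ (replicate N i) s (gap≡0⇒≡ (m+n≡0⇒m≡0 (gap (f [ s ]) _) eq₁)) ,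
      stage⇒θ↦ 𝟎 s′ (gap≡0⇒≡ (m+n≡0⇒m≡0 (gap (f [ s′ ]) _) eq₂)) ,
      refl
      where
      eq₁ = m+n≡0⇒n≡0 b eq
      eq₂ = m+n≡0⇒n≡0 (gap (f [ s ]) _) eq₁

    value∈extGraph : ∀ i w → value i w ∈ extGraph P (r i)
    value∈extGraph i w@(b ∷ s ∷ j ∷ s′ ∷ c ∷ xs) with tests i w in eq
    ... | suc d = inj₁ (xs , cong (λ z → ⟨ tuple P xs , z * suc (suc c) ⟩) (0∸n≡0 d))
    ... | zero  = inj₂ (xs , suc c , tests≡0⇒r↦ b s j s′ eq ,
                        cong (λ z → ⟨ tuple P xs , z ⟩) (*-identityˡ (suc (suc c))))

    extGraph⊆value : ∀ i {z} → z ∈ extGraph P (r i) → ∃[ w ] value i w ≡ z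
    extGraph⊆value i (inj₁ (xs , refl)) =
      1 ∷ 0 ∷ 0 ∷ 0 ∷ 0 ∷ xs ,
      -- With b = 1 the test number is the successor of the one for b = 0, so the factor reduces to
      -- 0 ∸ the latter.
      cong (λ z → ⟨ tuple P xs , z * 2 ⟩) (0∸n≡0 (tests i (0 ∷ 0 ∷ 0 ∷ 0 ∷ 0 ∷ xs)))
    extGraph⊆value i (inj₂ (xs , _ , (xs<a , j , c , θᵢ↦j , θ↦c , refl) , refl)) =
      let s  , fs≡  = θ↦⇒stage (replicate N i) θᵢ↦j
          s′ , fs′≡ = θ↦⇒stage 𝟎 θ↦c
          w         = 0 ∷ s ∷ j ∷ s′ ∷ c ∷ xs
          tests≡0 : tests i w ≡ 0
          tests≡0 = cong₂ _+_ (≡⇒gap≡0 fs≡)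
                   (cong₂ _+_ (≡⇒gap≡0 fs′≡)
                              (All<⇒excess≡0 a xs<a))
      in w , cong (λ z → ⟨ tuple P xs , z ⟩)
               (trans (cong (λ z → (1 ∸ z) * suc (suc c)) tests≡0)
                      (*-identityˡ (suc (suc c))))

    k : Vec ℕ 2 → ℕ
    k ys = value (head ys) (decode (5 + N) (head (tail ys)))

    k-enumerates : ∀ i → (λ z → ∃[ t ] k (i ∷ t ∷ []) ≡ z) ≐ extGraph P (r i)
    k-enumerates i = sound , complete
      where
      sound : ∀ {z} → (∃[ t ] k (i ∷ t ∷ []) ≡ z) → z ∈ extGraph P (r i)
      sound (t , refl) = value∈extGraph i (decode (5 + N) t)
      complete : ∀ {z} → z ∈ extGraph P (r i) → ∃[ t ] k (i ∷ t ∷ []) ≡ z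
      complete z∈ =
        let w , value≡z  = extGraph⊆value i z∈
            t , decode≡w = decode-surjective w
        in t , trans (cong (value i) decode≡w) value≡z

    k-computable : Computable f → Computable q → Computable k
    k-computable F Q =
      pair-computable (tuple-decode-computable n T₅)
        (*-computable
          (∸-computable (const-computable 1)
            (+-computable (left-computable T₀)
            (+-computable
              (gap-computable (comp₁-computable F (left-computable T₁))
                (pair-computable
                  (pair-computable I (tuple-replicate-computable n I))
                  (suc-computable J)))
            (+-computable
              (gap-computable (comp₁-computable F (left-computable T₃))
                (pair-computable
                  (pair-computable (comp₁-computable Q J)
                                   (const-computable (tuple P 𝟎)))
                  (suc-computable C)))
              (excess-decode-computable a N T₅)))))
          (suc-computable (suc-computable C)))
      where
      I  = head-computable
      -- `T₀` is the code t, and each later one codes what is left of the vector after dropping one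
      -- more entry. Thus b, s, j, s′, c are the left components of `T₀` to `T₄`, and `T₅` codes the
      -- argument vector.
      T₀ = second-computable
      T₁ = right-computable T₀
      T₂ = right-computable T₁
      T₃ = right-computable T₂
      T₄ = right-computable T₃
      T₅ = right-computable T₄
      J  = left-computable T₂
      C  = left-computable T₄

  -- The diagonal contradiction

  no-extension : (A : Pred ℕ 0ℓ) → ∀ {a} → a ∈ A → 0 < a →
    (n : ℕ) (θ : Family (suc n)) → IsQuasiGödelNumbering P A θ →
    (q : Vec ℕ 1 → ℕ) → Computable q →
    ¬ (∀ i → θ i ∈ Anf A →
       (θ (q [ i ]) ∈ 𝓡) × (graph P (θ i) ⊆ graph P (θ (q [ i ]))))
  no-extension A {a} a∈A 0<a n θ Q q Cq extends = c-undefined c-defined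
    where
    open IsQuasiGödelNumbering Q
    open Equivalence using (to; from)
    f = proj₁ qgnI
    open Diagonal n θ f q (proj₂ (proj₂ qgnI)) a

    -- Whether rᵢ is empty is not decided, so its membership in `𝓢 A` stays a hypothesis. It is
    -- supplied for i = m twice: under the assumption that c exists, and after that assumption has
    -- been refuted.
    reindexing : Σ[ v ∈ (Vec ℕ 1 → ℕ) ] Computable v × (∀ i → r i ∈ 𝓢 A → r i ≈ θ (v [ i ]))
    reindexing =
      let v , Cv , r≈ = qgnII k (k-computable (proj₁ (proj₂ qgnI)) Cq)
      in v , Cv , λ i rᵢ∈𝓢 → r≈ i (r i) rᵢ∈𝓢 (k-enumerates i)
    v = proj₁ reindexing

    v∘head : PartialFun (suc n)
    v∘head ._at_↦_ xs y = v [ head xs ] ≡ y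
    v∘head .singleValued refl refl = refl

    index : ∃[ m ] θ m ≈ v∘head
    index = proj₂ numbering v∘head
      (inj₁ ((λ xs → v [ head xs ]) ,
             comp₁-computable (proj₁ (proj₂ reindexing)) head-computable ,
             λ _ _ → mk⇔ (λ eq → eq) (λ eq → eq)))
    m = proj₁ index
    j = v [ m ]

    θₘ↦j : θ m at replicate (suc n) m ↦ j
    θₘ↦j = from (proj₂ index _ _) refl

    rₘ≈θⱼ : r m ∈ Anf A → r m ≈ θ j
    rₘ≈θⱼ rₘ∈Anf = proj₂ (proj₂ reindexing) m (inj₂ rₘ∈Anf)

    c-undefined : ¬ (∃[ c ] θ (q [ j ]) at 𝟎 ↦ c)
    c-undefined (c , θ↦c) = 1+n≢n (θ (q [ j ]) .singleValued θ↦suc-c θ↦c)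
      where
      -- Once c exists, the condition in the definition of rₘ is met and only the cube constraint
      -- remains.
      dom-rₘ : dom (r m) ≐ All (_< a)
      dom-rₘ = (λ (_ , xs<a , _) → xs<a) ,
               (λ xs<a → suc c , xs<a , j , c , θₘ↦j , θ↦c , refl)

      rₘ≈ : r m ≈ θ j
      rₘ≈ = rₘ≈θⱼ (inj₂ (a , a∈A , dom-rₘ))

      dom-θⱼ : dom (θ j) ≐ All (_< a)
      dom-θⱼ = (λ (y , θ↦) → proj₁ (from (rₘ≈ _ y) θ↦)) ,
               (λ xs<a → let y , r↦ = proj₂ dom-rₘ xs<a in y , to (rₘ≈ _ y) r↦)

      θⱼ↦ : θ j at 𝟎 ↦ suc c
      θⱼ↦ = to (rₘ≈ _ _)
        (All<-replicate0 (suc n) 0<a , j , c , θₘ↦j , θ↦c , refl)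

      -- The origin lies in the cube because a is positive, so the graph inclusion carries the value
      -- c + 1 there over to θ_{q(j)}, whose value is c.
      θ↦suc-c : θ (q [ j ]) at 𝟎 ↦ suc c
      θ↦suc-c = graph-at (θ (q [ j ]))
        (proj₂ (extends j (inj₂ (a , a∈A , dom-θⱼ))) (𝟎 , suc c , θⱼ↦ , refl))

    -- If c were undefined then rₘ, hence θⱼ, would be empty, and θ_{q(j)} total.
    c-defined : ∃[ c ] θ (q [ j ]) at 𝟎 ↦ c
    c-defined =
      let _ , _ , total = proj₁ (extends j (inj₁ θⱼ-empty))
      in _ , from (total _ _) refl
      where
      rₘ-empty : ∀ xs → ¬ (xs ∈ dom (r m))
      -- A point of the domain brings its own j′, which equals j because both are values of θₘ at
      -- (m, ..., m).
      rₘ-empty xs (_ , _ , j′ , c , θₘ↦j′ , θ↦c , _) = c-undefined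
        (c , subst (λ j → θ (q [ j ]) at 𝟎 ↦ c) (θ m .singleValued θₘ↦j′ θₘ↦j) θ↦c)

      θⱼ-empty : ∀ xs → ¬ (xs ∈ dom (θ j))
      θⱼ-empty xs (y , θ↦) = rₘ-empty xs (y , from (rₘ≈θⱼ (inj₁ rₘ-empty) xs y) θ↦)

theorem4p17 : (P : Pairing) (A : Pred ℕ 0ℓ) → Infinite A → CE A →
    (n : ℕ) .{{_ : NonZero n}} (θ : Family n) → IsQuasiGödelNumbering P A θ →
    ¬ (Σ[ q ∈ (Vec ℕ 1 → ℕ) ] Computable q ×
    (∀ i → θ i ∈ Anf A →
    (θ (q [ i ]) ∈ 𝓡) × (graph P (θ i) ⊆ graph P (θ (q [ i ])))))
theorem4p17 P A inf _ (suc n) θ Q (q , Cq , extends) =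
  infinite⇒¬¬positive inf λ (a , a∈A , 0<a) →
    no-extension P A a∈A 0<a n θ Q q Cq extends
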